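{- Let $r\ge3$ and let $\mathcal{H}$ be a connected $r$-uniform hypergraph on $n$ vertices whose longest Berge path has length $k$ with $1<k\le r$. Then there exists a nonempty set $S\subseteq V(\mathcal{H})$ such that $p_{\mathcal{H}}(e)=k$ for every $e\in N(S)$ and $S$ satisfies one of the following: (i) $k=r$, $|S|=r$ and $|N(S)|\le r$; (ii) $k=r$, $|S|\ge r+1$ and $|N(S)|\le r+1$; (iii) $1<k<r$, $|S|\ge r+1$ and $|N(S)|\le k$; (iv) $|S|=r-1$ and $|N(S)|=1$. Furthermore, $\mathcal{H}$ has a good set, i.e. $\mathcal{S}_r(\mathcal{H})\ne\emptyset$.
   Context: Hypergraphs are simple. A Berge path of length $k$ is an alternating sequence $v_0e_1v_1\cdots v_{k-1}e_kv_k$ of distinct vertices and distinct edges with $v_{i-1},v_i\in e_i$. Connected means every two distinct vertices are joined by a Berge path. $p_{\mathcal{H}}(e)$ is the maximum length of a Berge path having $e$ as a defining edge. For $S\subseteq V(\mathcal{H})$, $N(S)=\{e\in E(\mathcal{H}):e\cap S\neq\emptyset\}$. For real $x\ge1$, $f_r(x)=\frac1r$ if $x=1$, $\frac{x}{r+1}$ if $1<x\le r-1$, $\frac1r\binom{x}{r-1}$ if $x\ge r$. If the longest Berge path of $\mathcal{H}$ has length $k$, a good set is a nonempty $S\subseteq V(\mathcal{H})$ with $p_{\mathcal{H}}(e)=k$ for all $e\in N(S)$ and $|N(S)|\le f_r(k)|S|$; $\mathcal{S}_r(\mathcal{H})$ is the family of all good sets. -}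

module Defs where

open import Data.Nat using (ℕ; zero; suc; _+_; _*_; _∸_; _≤_; _<_)
open import Data.Nat.Combinatorics using (_C_)
open import Data.Fin using (Fin; inject₁; fromℕ) renaming (suc to fsuc; zero to fzero)
open import Data.Fin.Subset using (Subset; _∈_; _∩_; ∣_∣; Nonempty)
open import Data.Fin.Subset.Properties using (nonempty?)
open import Data.Vec using (tabulate)
open import Data.Product using (Σ; ∃; _×_; _,_)
open import Data.Sum using (_⊎_)
open import Relation.Nullary using (¬_; does)
open import Relation.Binary.PropositionalEquality using (_≡_)
open import Function.Definitions using (Injective)

record Hypergraph (n : ℕ) : Set where
  field
    m      : ℕ
    edge   : Fin m → Subset n
    simple : Injective _≡_ _≡_ edge
open Hypergraph public

Uniform : ∀ {n} → ℕ → Hypergraph n → Set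
Uniform r H = ∀ i → ∣ edge H i ∣ ≡ r

record BergePath {n : ℕ} (H : Hypergraph n) (k : ℕ) : Set where
  field
    vert     : Fin (suc k) → Fin n
    edg      : Fin k → Fin (m H)
    vertInj  : Injective _≡_ _≡_ vert
    edgInj   : Injective _≡_ _≡_ edg
    incident : ∀ i → (vert (inject₁ i) ∈ edge H (edg i)) × (vert (fsuc i) ∈ edge H (edg i))
open BergePath public

UsesEdge : ∀ {n} {H : Hypergraph n} {k} → BergePath H k → Fin (m H) → Set
UsesEdge {k = k} P e = ∃ λ (i : Fin k) → edg P i ≡ e

Connected : ∀ {n} → Hypergraph n → Set
Connected {n} H = ∀ (u v : Fin n) → ¬ (u ≡ v) →
  ∃ λ k → Σ (BergePath H k) λ P → (vert P fzero ≡ u) × (vert P (fromℕ k) ≡ v)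

LongestPathLength : ∀ {n} → Hypergraph n → ℕ → Set
LongestPathLength H k = BergePath H k × (∀ j → BergePath H j → j ≤ k)

PathNumber : ∀ {n} (H : Hypergraph n) → Fin (m H) → ℕ → Set
PathNumber H e k =
  (Σ (BergePath H k) λ P → UsesEdge P e) ×
  (∀ j → (P : BergePath H j) → UsesEdge P e → j ≤ k)

N : ∀ {n} (H : Hypergraph n) → Subset n → Subset (m H)
N H S = tabulate λ i → does (nonempty? (edge H i ∩ S))

-- Bound r x a b  means  a ≤ f_r(x) · b, with f_r as in the paper
-- (denominators cleared):
--   x = 1          : f_r(x) = 1/r
--   1 < x ≤ r - 1  : f_r(x) = x/(r+1)
--   x ≥ r          : f_r(x) = (1/r)·C(x, r-1)
Bound : ℕ → ℕ → ℕ → ℕ → Set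
Bound r x a b =
    (x ≡ 1 × r * a ≤ b)
  ⊎ ((1 < x × x ≤ r ∸ 1) × (suc r) * a ≤ x * b)
  ⊎ (r ≤ x × r * a ≤ (x C (r ∸ 1)) * b)

-- S is a good set of H, where k is the length of the longest Berge path of H
GoodSet : ∀ {n} (H : Hypergraph n) (r k : ℕ) → Subset n → Set
GoodSet H r k S =
  Nonempty S × (∀ e → e ∈ N H S → PathNumber H e k) × Bound r k ∣ N H S ∣ ∣ S ∣

{-# OPTIONS --safe #-}

-- Let v₀ e₁ v₁ … eₖ vₖ be a longest Berge path and call a vertex an endpoint if it starts a path with
-- exactly the edges e₁, …, eₖ. Put U = {v₁, …, vₖ}. Every vertex of e₁ outside U is an endpoint. If
-- vᵢ ∈ e₁ with i ≥ 2, take w ∈ eᵢ outside U (if there is none, eᵢ closes a k-cycle): rotating the path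
-- makes w an endpoint, and if w was already collected, a second rotation makes vᵢ₋₁ one. So every
-- vertex of e₁ other than v₁ yields its own endpoint; vₖ is one more, and a vertex of eₖ outside U
-- another, which exists when k < r. Hence there is a k-cycle, or there are at least r endpoints
-- (r + 1 if k < r).
--
-- If k < r, an edge off the path through an endpoint would make the path longer, and a k-cycle also
-- has r + 1 endpoints, so S may consist of endpoints. If k = r, an edge off the path through an
-- endpoint closes an r- or (r + 1)-cycle. The edges meeting an (r + 1)-cycle are exactly its edges;
-- for an r-cycle either the same holds, or an edge off the cycle adds a vertex w such that all edges
-- meeting the cycle or w lie inside these r + 1 vertices.
module Submission where

open import Defs
open import Data.Nat using (ℕ; zero; suc; pred; _+_; _*_; _∸_; _≤_; _<_; z≤n; s≤s)
open import Data.Nat.Properties using (*-comm; *-mono-≤; *-monoʳ-≤; <⇒≤pred; m∸n≤m; m∸[m∸n]≡n; ≤-trans; ≤-refl; ≤-reflexive; <-irrefl; ≤-antisym; m≤m+n; m<m+n; suc-injective; m≤n⇒m<n∨m≡n; <⇒≤; n≤1+n; +-suc; +-identityʳ)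
open import Data.Nat.Combinatorics using (nCk≡nC[n∸k]; nC1≡n) renaming (_C_ to _choose_)
open import Data.Bool using (true)
open import Data.Fin using (Fin; inject₁; fromℕ) renaming (suc to fsuc; zero to fzero; _<_ to _<ᶠ_)
open import Data.Fin.Properties using (pigeonhole; any?) renaming (_≟_ to _≟ᶠ_; suc-injective to fsuc-injective; <⇒≢ to <⇒≢ᶠ)
open import Data.Fin.Subset using (Subset; ∣_∣; Nonempty; inside; outside; _∈_; _∉_; _∩_)
open import Data.Fin.Subset.Properties using (⊆-antisym; nonempty?; x∈p∩q⁻) renaming (_∈?_ to _∈ˢ?_)
open import Data.Vec using ([]; _∷_; tabulate) renaming (here to vhere; there to vthere)
import Data.Vec.Properties as Vec
open import Data.List using (List; []; _∷_; _++_; length; map; filter; lookup; [_])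
import Data.List as List
open import Data.List.Properties using (length-map; length-tabulate; length-++; ++-identityʳ; filter-accept; filter-reject)
open import Data.List.Membership.Propositional using () renaming (_∈_ to _∈ˡ_; _∉_ to _∉ˡ_)
open import Data.List.Membership.Propositional.Properties using (∈-map⁺; ∈-map⁻; ∈-∃++; ∈-++⁻; ∈-++⁺ˡ; ∈-++⁺ʳ; ∈-lookup; ∈-filter⁺; ∈-filter⁻)
import Data.List.Membership.DecPropositional as DecMembership
open import Data.List.Relation.Binary.Permutation.Propositional using (_↭_; ↭⇒↭ₛ; ↭-refl; ↭-sym; ↭-trans; prep)
open import Data.List.Relation.Binary.Permutation.Propositional.Properties using (∈-resp-↭; ↭-length; shift; ++-comm; ++⁺; ++-commutativeMonoid)
import Data.List.Relation.Binary.Permutation.Setoid.Properties as SetoidPerm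
open import Data.List.Relation.Binary.Subset.Propositional using (_⊆_)
open import Data.List.Relation.Unary.All using (All; []; _∷_)
import Data.List.Relation.Unary.All as All
import Data.List.Relation.Unary.All.Properties as All
open import Data.List.Relation.Unary.Any using (here; there; index)
open import Data.List.Relation.Unary.Any.Properties using (lookup-index)
open import Data.List.Relation.Unary.AllPairs using ([]; _∷_)
open import Data.List.Relation.Unary.Unique.Propositional using (Unique)
import Data.List.Relation.Unary.Unique.Propositional.Properties as Unique
import Algebra.Solver.CommutativeMonoid
open import Data.Product using (Σ; ∃; _×_; _,_; proj₁; proj₂)
open import Data.Sum using (_⊎_; inj₁; inj₂; [_,_]′)
open import Data.Empty using (⊥; ⊥-elim)
open import Relation.Nullary using (¬_; Dec; yes; no; does; ¬?)
open import Relation.Nullary.Decidable using (dec-true; decidable-stable; _×-dec_)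
open import Relation.Binary.PropositionalEquality using (setoid; _≡_; _≢_; refl; sym; trans; cong; subst; subst₂)
open import Function using (_∘_; case_of_)
open import Function.Definitions using (Injective)

-- Duplicate-free lists and finite subsets.

private
  variable
    A : Set
    n : ℕ

_∈?_ : (x : Fin n) (xs : List (Fin n)) → Dec (x ∈ˡ xs)
_∈?_ = DecMembership._∈?_ _≟ᶠ_

lookup-injective : {xs : List A} → Unique xs → Injective _≡_ _≡_ (lookup xs)
lookup-injective {xs = x ∷ xs} (x∉ ∷ u) {fzero}  {fzero}  _  = refl
lookup-injective {xs = x ∷ xs} (x∉ ∷ u) {fzero}  {fsuc j} eq = ⊥-elim (All.lookup x∉ (∈-lookup j) eq)
lookup-injective {xs = x ∷ xs} (x∉ ∷ u) {fsuc i} {fzero}  eq = ⊥-elim (All.lookup x∉ (∈-lookup i) (sym eq))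
lookup-injective {xs = x ∷ xs} (x∉ ∷ u) {fsuc i} {fsuc j} eq = cong fsuc (lookup-injective u eq)

unique-∷ : {x : A} {xs : List A} → x ∉ˡ xs → Unique xs → Unique (x ∷ xs)
unique-∷ x∉ u = All.tabulate (λ y∈ x≡y → x∉ (subst (_∈ˡ _) (sym x≡y) y∈)) ∷ u

unique-head : {x : A} {xs : List A} → Unique (x ∷ xs) → x ∉ˡ xs
unique-head (x∉ ∷ _) x∈ = All.lookup x∉ x∈ refl

unique-tail : {x : A} {xs : List A} → Unique (x ∷ xs) → Unique xs
unique-tail (_ ∷ u) = u

-- The leftover `zs` measures the gap between the lists: it gives the length inequality and, when
-- empty, the equality case.
⊆-complement : {xs ys : List A} → Unique xs → xs ⊆ ys → ∃ λ zs → ys ↭ xs ++ zs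
⊆-complement {xs = []}     {ys} _ _ = ys , ↭-refl
⊆-complement {xs = x ∷ xs} {ys} (x∉ ∷ u) xs⊆ with ∈-∃++ (xs⊆ (here refl))
... | as , bs , refl with ⊆-complement {xs = xs} {as ++ bs} u rest
  where
  rest : xs ⊆ as ++ bs
  rest z∈ with ∈-++⁻ as (xs⊆ (there z∈))
  ... | inj₁ z∈as          = ∈-++⁺ˡ z∈as
  ... | inj₂ (here z≡x)    = ⊥-elim (All.lookup x∉ z∈ (sym z≡x))
  ... | inj₂ (there z∈bs)  = ∈-++⁺ʳ as z∈bs
... | zs , p = zs , ↭-trans (shift x as bs) (prep x p)

⊆-length : {xs ys : List A} → Unique xs → xs ⊆ ys → length xs ≤ length ys
⊆-length {xs = xs} u xs⊆ with ⊆-complement u xs⊆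
... | zs , p = subst (length xs ≤_) (sym (trans (↭-length p) (length-++ xs))) (m≤m+n _ _)

⊆-full : {xs ys : List A} → Unique xs → xs ⊆ ys → length ys ≤ length xs → ys ⊆ xs
⊆-full {xs = xs} u xs⊆ le with ⊆-complement u xs⊆
... | [] , p = λ y∈ → subst (_ ∈ˡ_) (++-identityʳ xs) (∈-resp-↭ p y∈)
... | z ∷ zs , p = ⊥-elim (<-irrefl refl (≤-trans (m<m+n (length xs) (s≤s z≤n))
        (subst (_≤ length xs) (trans (↭-length p) (length-++ xs)) le)))

elements : Subset n → List (Fin n)
elements []             = []
elements (inside  ∷ p)  = fzero ∷ map fsuc (elements p)
elements (outside ∷ p)  = map fsuc (elements p)

length-elements : (p : Subset n) → length (elements p) ≡ ∣ p ∣
length-elements []            = refl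
length-elements (inside  ∷ p) = cong suc (trans (length-map fsuc (elements p)) (length-elements p))
length-elements (outside ∷ p) = trans (length-map fsuc (elements p)) (length-elements p)

∈-elements⁺ : {p : Subset n} {x : Fin n} → x ∈ p → x ∈ˡ elements p
∈-elements⁺ {p = inside  ∷ p} {fzero}  vhere      = here refl
∈-elements⁺ {p = inside  ∷ p} {fsuc x} (vthere x∈) = there (∈-map⁺ fsuc (∈-elements⁺ x∈))
∈-elements⁺ {p = outside ∷ p} {fsuc x} (vthere x∈) = ∈-map⁺ fsuc (∈-elements⁺ x∈)

∈-elements⁻ : {p : Subset n} {x : Fin n} → x ∈ˡ elements p → x ∈ p
∈-elements⁻ {p = inside  ∷ p} (here refl) = vhere
∈-elements⁻ {p = inside  ∷ p} (there x∈) with ∈-map⁻ fsuc x∈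
... | y , y∈ , refl = vthere (∈-elements⁻ y∈)
∈-elements⁻ {p = outside ∷ p} x∈ with ∈-map⁻ fsuc x∈
... | y , y∈ , refl = vthere (∈-elements⁻ y∈)

elements-unique : (p : Subset n) → Unique (elements p)
elements-unique []            = []
elements-unique (inside  ∷ p) = unique-∷ (λ z∈ → case ∈-map⁻ fsuc z∈ of λ { (_ , _ , ()) })
                                  (Unique.map⁺ fsuc-injective (elements-unique p))
elements-unique (outside ∷ p) = Unique.map⁺ fsuc-injective (elements-unique p)

∣∣≤length : (p : Subset n) {xs : List (Fin n)} → (∀ {x} → x ∈ p → x ∈ˡ xs) → ∣ p ∣ ≤ length xs
∣∣≤length p h = subst (_≤ _) (length-elements p) (⊆-length (elements-unique p) (h ∘ ∈-elements⁻))

length≤∣∣ : (p : Subset n) {xs : List (Fin n)} → Unique xs → (∀ {x} → x ∈ˡ xs → x ∈ p) → length xs ≤ ∣ p ∣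
length≤∣∣ p u h = subst (_ ≤_) (length-elements p) (⊆-length u (∈-elements⁺ ∘ h))

does-true : {P : Set} (P? : Dec P) → does P? ≡ true → P
does-true (yes p) _ = p

∈-tabulate⁺ : {P : Fin n → Set} (P? : ∀ x → Dec (P x)) {x : Fin n} → P x → x ∈ tabulate (does ∘ P?)
∈-tabulate⁺ P? {x} px = Vec.lookup⇒[]= x _ (trans (Vec.lookup∘tabulate _ x) (dec-true (P? x) px))

∈-tabulate⁻ : {P : Fin n → Set} (P? : ∀ x → Dec (P x)) {x : Fin n} → x ∈ tabulate (does ∘ P?) → P x
∈-tabulate⁻ P? {x} x∈ = does-true (P? x) (trans (sym (Vec.lookup∘tabulate _ x)) (Vec.[]=⇒lookup x∈))

fromList : List (Fin n) → Subset n
fromList xs = tabulate (λ x → does (x ∈? xs))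

∈-fromList⁺ : {xs : List (Fin n)} {x : Fin n} → x ∈ˡ xs → x ∈ fromList xs
∈-fromList⁺ {xs = xs} = ∈-tabulate⁺ (_∈? xs)

∈-fromList⁻ : {xs : List (Fin n)} {x : Fin n} → x ∈ fromList xs → x ∈ˡ xs
∈-fromList⁻ {xs = xs} = ∈-tabulate⁻ (_∈? xs)

∣fromList∣ : {xs : List (Fin n)} → Unique xs → ∣ fromList xs ∣ ≡ length xs
∣fromList∣ {xs = xs} u =
  ≤-antisym (∣∣≤length (fromList xs) (∈-fromList⁻ {xs = xs})) (length≤∣∣ (fromList xs) u ∈-fromList⁺)

unique-resp-↭ : {xs ys : List A} → xs ↭ ys → Unique xs → Unique ys
unique-resp-↭ {A = A} p = SetoidPerm.Unique-resp-↭ (setoid A) (↭⇒↭ₛ p)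

unique-prefix : (xs : List A) {ys : List A} → Unique (xs ++ ys) → Unique xs
unique-prefix []       _        = []
unique-prefix (x ∷ xs) (x∉ ∷ u) = All.++⁻ˡ xs x∉ ∷ unique-prefix xs u

-- Up to `↭`, concatenation is a commutative monoid, so most reorderings of path segments can be
-- left to a solver.
module MonoidSolver {A : Set} = Algebra.Solver.CommutativeMonoid (++-commutativeMonoid {A = A})
open MonoidSolver using (solve; _⊕_; _⊜_; id)

-- Walks, paths up to order, and cycles.

module Paths {n : ℕ} (H : Hypergraph n) where

  V E : Set
  V = Fin n
  E = Fin (m H)

  infix 4 _∈ₑ_ _∉ₑ_
  _∈ₑ_ _∉ₑ_ : V → E → Set
  x ∈ₑ e = x ∈ edge H e
  x ∉ₑ e = x ∉ edge H e

  private
    variable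
      u v w x y z : V
      e f g : E
      us vs ws : List V
      es fs : List E

  -- The first vertex of a walk is not in its vertex list, so both lists have the length of the walk.
  data Walk : V → List V → List E → V → Set where
    stop : Walk u [] [] u
    step : u ∈ₑ e → x ∈ₑ e → Walk x vs es v → Walk u (x ∷ vs) (e ∷ es) v

  -- A walk whose vertices (now including the first one) and edges are known up to order.
  Link : V → List V → List E → V → Set
  Link u ws es v = ∃ λ vs → ∃ λ fs → Walk u vs fs v × u ∷ vs ↭ ws × fs ↭ es

  relabel : us ↭ ws → es ↭ fs → Link u us es v → Link u ws fs v
  relabel p q (_ , _ , P , p′ , q′) = _ , _ , P , ↭-trans p′ p , ↭-trans q′ q

  walk : Walk u vs es v → Link u (u ∷ vs) es v
  walk P = _ , _ , P , ↭-refl , ↭-refl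

  _◅_ : u ∈ₑ e × x ∈ₑ e → Link x ws es v → Link u (u ∷ ws) (e ∷ es) v
  (u∈ , x∈) ◅ (_ , _ , P , p , q) = _ , _ , step u∈ x∈ P , prep _ p , prep _ q

  walk-join : Walk u vs es x → x ∈ₑ e → y ∈ₑ e → Walk y ws fs v → Walk u (vs ++ y ∷ ws) (es ++ e ∷ fs) v
  walk-join stop           x∈ y∈ Q = step x∈ y∈ Q
  walk-join (step a∈ b∈ P) x∈ y∈ Q = step a∈ b∈ (walk-join P x∈ y∈ Q)

  join : Link u us es x → x ∈ₑ e × y ∈ₑ e → Link y ws fs v → Link u (us ++ ws) (e ∷ es ++ fs) v
  join (_ , es , P , p , q) (x∈ , y∈) (_ , fs , Q , p′ , q′) =
    _ , _ , walk-join P x∈ y∈ Q , ++⁺ p p′ , ↭-trans (shift _ es fs) (prep _ (++⁺ q q′))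

  walk-reverse : Walk u vs es v → Link v (u ∷ vs) es u
  walk-reverse stop           = walk stop
  walk-reverse (step {u = u} {x = x} {vs = vs} {es = es} u∈ x∈ P) =
    relabel (++-comm (x ∷ vs) [ u ]) (prep _ (++-comm es [])) (join (walk-reverse P) (x∈ , u∈) (walk stop))

  reverse : Link u ws es v → Link v ws es u
  reverse (_ , _ , P , p , q) = relabel p q (walk-reverse P)

  start∈ : Link u ws es v → u ∈ˡ ws
  start∈ (_ , _ , _ , p , _) = ∈-resp-↭ p (here refl)

  end∈ : Link u ws es v → v ∈ˡ ws
  end∈ L = start∈ (reverse L)

  link-length : Link u ws es v → length ws ≡ suc (length es)
  link-length (_ , _ , P , p , q) =
    trans (sym (↭-length p)) (cong suc (trans (walk-length P) (↭-length q)))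
    where
    walk-length : Walk u vs es v → length vs ≡ length es
    walk-length stop         = refl
    walk-length (step _ _ P) = cong suc (walk-length P)

  -- A walk through the edge e, traversed towards z, taken apart at e.
  Split : V → List V → List E → V → E → V → Set
  Split u vs es v e z =
    ∃ λ y → ∃ λ vs₁ → ∃ λ es₁ → ∃ λ vs₂ → ∃ λ es₂ →
      Link u (u ∷ vs₁) es₁ y × y ∈ₑ e × z ∈ₑ e × Link z vs₂ es₂ v ×
      vs ↭ vs₁ ++ vs₂ × es ↭ e ∷ es₁ ++ es₂

  split-here : u ∈ₑ e → x ∈ₑ e → Walk x vs es v → Split u (x ∷ vs) (e ∷ es) v e x
  split-here u∈ x∈ P = _ , [] , [] , _ , _ , walk stop , u∈ , x∈ , walk P , ↭-refl , ↭-refl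

  split-there : u ∈ₑ f → x ∈ₑ f → Split x vs es v e z → Split u (x ∷ vs) (f ∷ es) v e z
  split-there {f = f} {e = e} u∈ x∈ (_ , _ , es₁ , _ , es₂ , P₁ , y∈ , z∈ , P₂ , p , q) =
    _ , _ , _ , _ , _ , (u∈ , x∈) ◅ P₁ , y∈ , z∈ , P₂ , prep _ p ,
    ↭-trans (prep f q) (solve 4 (λ f e a b → f ⊕ (e ⊕ (a ⊕ b)) ⊜ e ⊕ ((f ⊕ a) ⊕ b)) ↭-refl [ f ] [ e ] es₁ es₂)

  split-vertex : z ∈ˡ vs → Walk u vs es v → ∃ λ e → Split u vs es v e z
  split-vertex (here refl) (step u∈ x∈ P) = _ , split-here u∈ x∈ P
  split-vertex (there z∈)  (step u∈ x∈ P) with split-vertex z∈ P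
  ... | e , S = e , split-there u∈ x∈ S

  split-edge : e ∈ˡ es → Walk u vs es v → ∃ λ z → Split u vs es v e z
  split-edge (here refl) (step u∈ x∈ P) = _ , split-here u∈ x∈ P
  split-edge (there e∈)  (step u∈ x∈ P) with split-edge e∈ P
  ... | z , S = z , split-there u∈ x∈ S

  -- Passing between walks and Berge paths.

  vertex : Walk u vs es v → Fin (suc (length es)) → V
  vertex {u = u} P              fzero    = u
  vertex         (step _ _ P)   (fsuc i) = vertex P i

  vertex∈ : (P : Walk u vs es v) (i : Fin (suc (length es))) → vertex P i ∈ˡ u ∷ vs
  vertex∈ P              fzero    = here refl
  vertex∈ (step _ _ P)   (fsuc i) = there (vertex∈ P i)

  vertex-injective : (P : Walk u vs es v) → Unique (u ∷ vs) → Injective _≡_ _≡_ (vertex P)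
  vertex-injective P            uniq {fzero}  {fzero}  eq = refl
  vertex-injective (step _ _ P) uniq {fzero}  {fsuc j} eq =
    ⊥-elim (unique-head uniq (subst (_∈ˡ _) (sym eq) (vertex∈ P j)))
  vertex-injective (step _ _ P) uniq {fsuc i} {fzero}  eq =
    ⊥-elim (unique-head uniq (subst (_∈ˡ _) eq (vertex∈ P i)))
  vertex-injective (step _ _ P) uniq {fsuc i} {fsuc j} eq =
    cong fsuc (vertex-injective P (unique-tail uniq) eq)

  vertex-incident : (P : Walk u vs es v) (i : Fin (length es)) →
    vertex P (inject₁ i) ∈ₑ lookup es i × vertex P (fsuc i) ∈ₑ lookup es i
  vertex-incident (step u∈ x∈ P) fzero    = u∈ , x∈
  vertex-incident (step u∈ x∈ P) (fsuc i) = vertex-incident P i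

  toBerge : Walk u vs es v → Unique (u ∷ vs) → Unique es →
    Σ (BergePath H (length es)) λ P → ∀ {e} → e ∈ˡ es → UsesEdge P e
  toBerge {es = es} P uv ue = record
    { vert     = vertex P
    ; edg      = lookup es
    ; vertInj  = vertex-injective P uv
    ; edgInj   = lookup-injective ue
    ; incident = vertex-incident P
    } , λ e∈ → index e∈ , sym (lookup-index e∈)

  fromBerge : ∀ {k} → BergePath H k →
    ∃ λ u → ∃ λ vs → ∃ λ es → ∃ λ v → Walk u vs es v × Unique (u ∷ vs) × Unique es × length es ≡ k
  fromBerge P = _ , _ , _ , _ , build (vert P) (edg P) (incident P)
              , Unique.tabulate⁺ (vertInj P) , Unique.tabulate⁺ (edgInj P) , length-tabulate (edg P)
    where
    build : ∀ {k} (a : Fin (suc k) → V) (b : Fin k → E) →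
      (∀ i → a (inject₁ i) ∈ₑ b i × a (fsuc i) ∈ₑ b i) →
      Walk (a fzero) (List.tabulate (a ∘ fsuc)) (List.tabulate b) (a (fromℕ k))
    build {zero}  a b inc = stop
    build {suc k} a b inc =
      step (proj₁ (inc fzero)) (proj₂ (inc fzero)) (build (a ∘ fsuc) (b ∘ fsuc) (inc ∘ fsuc))

  -- A cycle with vertices vs and edges fs, cut open at its edge f between v and u.
  Cycle : V → V → E → List V → List E → Set
  Cycle u v f vs fs = ∃ λ es → Link u vs es v × u ∈ₑ f × v ∈ₑ f × f ∷ es ↭ fs

  cycle-reverse : Cycle u v f vs fs → Cycle v u f vs fs
  cycle-reverse (_ , P , u∈ , v∈ , q) = _ , reverse P , v∈ , u∈ , q

  cycle-length : Cycle u v f vs fs → length vs ≡ length fs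
  cycle-length (_ , P , _ , _ , q) = trans (link-length P) (↭-length q)

  -- The closing edge `f` leads from `v` back to `u`, so the cycle can be opened at `e` instead: the
  -- new path runs from `z` to `v`, over `f` to `u`, and on to `y`.
  cut-split : Split u ws es v e z → u ∈ₑ f → v ∈ₑ f → u ∷ ws ↭ vs → f ∷ es ↭ fs → ∃ λ y → Cycle z y e vs fs
  cut-split {u = u} {e = e} {f = f} (y , vs₁ , es₁ , vs₂ , es₂ , P₁ , y∈ , z∈ , P₂ , p , q) u∈ v∈ p′ q′ =
    y , _ , relabel vertices ↭-refl (join P₂ (v∈ , u∈) P₁) , z∈ , y∈ , edges
    where
    vertices = ↭-trans (solve 3 (λ u a b → b ⊕ (u ⊕ a) ⊜ u ⊕ (a ⊕ b)) ↭-refl [ u ] vs₁ vs₂)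
                       (↭-trans (prep u (↭-sym p)) p′)
    edges    = ↭-trans (solve 4 (λ e f a b → e ⊕ (f ⊕ (b ⊕ a)) ⊜ f ⊕ (e ⊕ (a ⊕ b))) ↭-refl [ e ] [ f ] es₁ es₂)
                       (↭-trans (prep f (↭-sym q)) q′)

  cut-vertex : z ∈ˡ vs → Cycle u v f vs fs → ∃ λ y → ∃ λ e → Cycle z y e vs fs
  cut-vertex z∈ C@(_ , (_ , _ , P , p , q) , u∈ , v∈ , q′) with ∈-resp-↭ (↭-sym p) z∈
  ... | here refl  = _ , _ , C
  ... | there z∈ws with split-vertex z∈ws P
  ...   | e , S with cut-split S u∈ v∈ p (↭-trans (prep _ q) q′)
  ...     | y , C′ = y , e , C′

  cut-edge : e ∈ˡ fs → Cycle u v f vs fs → ∃ λ z → ∃ λ y → Cycle z y e vs fs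
  cut-edge e∈ C@(_ , (_ , _ , P , p , q) , u∈ , v∈ , q′) with ∈-resp-↭ (↭-sym q′) e∈
  ... | here refl  = _ , _ , C
  ... | there e∈es with split-edge (∈-resp-↭ (↭-sym q) e∈es) P
  ...   | z , S with cut-split S u∈ v∈ p (↭-trans (prep _ q) q′)
  ...     | y , C′ = z , y , C′

  -- The first step of the opened path is the second cycle edge at `u`; moving `u` to the far end of
  -- the path opens the cycle there. In a 2-cycle both neighbours of `u` coincide, hence the
  -- condition on `length vs`.
  other-neighbour : Unique vs → Unique fs → 2 ≤ length vs → Cycle u v f vs fs →
    ∃ λ x → ∃ λ e → Cycle u x e vs fs × f ≢ e × (3 ≤ length vs → v ≢ x)
  other-neighbour uv uf 2≤ (es , (_ , _ , stop , p , q) , u∈f , v∈ , q′) =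
    ⊥-elim (<-irrefl refl (subst (2 ≤_) (sym (↭-length p)) 2≤))
  other-neighbour {vs = vs} {u = u} {v = v} {f = f} uv uf 2≤
      (_ , (x ∷ ws , e ∷ es , step u∈ x∈ P , p , q) , u∈f , v∈ , q′) =
    x , e , cycle-reverse (_ , relabel (↭-trans (++-comm (x ∷ ws) [ u ]) p) ↭-refl (join (walk P) (v∈ , u∈f) (walk stop))
              , x∈ , u∈ , ↭-trans (solve 3 (λ e f a → e ⊕ (f ⊕ (a ⊕ id)) ⊜ f ⊕ (e ⊕ a)) ↭-refl [ e ] [ f ] es) q″)
      , (λ f≡e → unique-head (unique-resp-↭ (↭-sym q″) uf) (here f≡e))
      , λ 3≤ v≡x → distinct P (subst (3 ≤_) (sym (↭-length p)) 3≤) (unique-tail (unique-resp-↭ (↭-sym p) uv)) v≡x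
    where
    q″ = ↭-trans (prep f q) q′
    distinct : Walk x ws es v → 3 ≤ suc (suc (length ws)) → Unique (x ∷ ws) → v ≢ x
    distinct stop (s≤s (s≤s ())) _ _
    distinct (step _ _ Q) _ uniq refl = unique-head uniq (end∈ (walk Q))

-- Edges inside sets of `r` or `r + 1` vertices.

module UniformEdges {n : ℕ} (H : Hypergraph n) {r : ℕ} (uniform : Uniform r H) where

  open Paths H

  private
    variable
      x y : V
      e f g : E
      ws : List V
      fs : List E

  infix 4 _⊆ᵥ_
  _⊆ᵥ_ : E → List V → Set
  e ⊆ᵥ ws = ∀ {x} → x ∈ₑ e → x ∈ˡ ws

  vertices : E → List V
  vertices e = elements (edge H e)

  length-vertices : ∀ e → length (vertices e) ≡ r
  length-vertices e = trans (length-elements (edge H e)) (uniform e)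

  outsider? : ∀ e ws → (∃ λ x → x ∈ₑ e × x ∉ˡ ws) ⊎ e ⊆ᵥ ws
  outsider? e ws with any? (λ x → (x ∈ˢ? edge H e) ×-dec ¬? (x ∈? ws))
  ... | yes out = inj₁ out
  ... | no none = inj₂ λ {x} x∈ → decidable-stable (x ∈? ws) (λ x∉ → none (x , x∈ , x∉))

  ⊆ᵥ-size : e ⊆ᵥ ws → r ≤ length ws
  ⊆ᵥ-size {e} e⊆ = subst (_≤ _) (length-vertices e) (⊆-length (elements-unique (edge H e)) (e⊆ ∘ ∈-elements⁻))

  ⊆ᵥ-covers : e ⊆ᵥ ws → length ws ≤ r → x ∈ˡ ws → x ∈ₑ e
  ⊆ᵥ-covers {e} e⊆ le x∈ = ∈-elements⁻
    (⊆-full (elements-unique (edge H e)) (e⊆ ∘ ∈-elements⁻) (subst (_ ≤_) (sym (length-vertices e)) le) x∈)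

  -- Each edge fills `ws`, and simplicity identifies edges with the same vertices.
  ⊆ᵥ-same : e ⊆ᵥ ws → f ⊆ᵥ ws → length ws ≤ r → e ≡ f
  ⊆ᵥ-same e⊆ f⊆ le = simple H (⊆-antisym (λ x∈ → ⊆ᵥ-covers f⊆ le (e⊆ x∈)) (λ x∈ → ⊆ᵥ-covers e⊆ le (f⊆ x∈)))

  edge-⊆ : (∀ {x} → x ∈ₑ e → x ∈ₑ f) → e ≡ f
  edge-⊆ {e} {f} e⊆f = ⊆ᵥ-same (∈-elements⁺ ∘ e⊆f) ∈-elements⁺ (≤-reflexive (length-vertices f))

  -- Otherwise `x`, `y` and the `r` vertices of `e` would be `r + 2` distinct vertices of `ws`.
  misses-one : Unique ws → length ws ≤ suc r → e ⊆ᵥ ws → x ∈ˡ ws → x ∉ₑ e → y ∈ˡ ws → x ≢ y → y ∈ₑ e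
  misses-one {ws} {e} {x} {y} u le e⊆ x∈ x∉ y∈ x≢y with y ∈ˢ? edge H e
  ... | yes y∈e = y∈e
  ... | no  y∉e = ⊥-elim (<-irrefl refl (≤-trans (subst (λ l → suc (suc l) ≤ length ws) (length-vertices e)
                    (⊆-length (unique-∷ x∉′ (unique-∷ (y∉e ∘ ∈-elements⁻) (elements-unique (edge H e)))) sub)) le))
    where
    x∉′ : x ∉ˡ y ∷ vertices e
    x∉′ (here x≡y) = x≢y x≡y
    x∉′ (there x∈e) = x∉ (∈-elements⁻ x∈e)
    sub : x ∷ y ∷ vertices e ⊆ ws
    sub (here refl) = x∈
    sub (there (here refl)) = y∈
    sub (there (there z∈)) = e⊆ (∈-elements⁻ z∈)

  missing : Unique ws → r < length ws → ∀ e → ∃ λ t → t ∈ˡ ws × t ∉ₑ e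
  missing {ws} uw r< e with any? (λ t → (t ∈? ws) ×-dec ¬? (t ∈ˢ? edge H e))
  ... | yes m = m
  ... | no none = ⊥-elim (<-irrefl refl (≤-trans r< (subst (length ws ≤_) (length-vertices e)
                    (⊆-length uw λ {t} t∈ → ∈-elements⁺ (decidable-stable (t ∈ˢ? edge H e) (λ t∉ → none (t , t∈ , t∉)))))))

  -- Sending an edge to the vertex of ws that it misses is injective.
  all-subsets : Unique ws → length ws ≡ suc r → (∀ {f} → f ∈ˡ fs → f ⊆ᵥ ws) → Unique fs →
    length ws ≤ length fs → g ⊆ᵥ ws → g ∈ˡ fs
  all-subsets {ws} {fs} {g} uw lw fs⊆ uf le g⊆ with g ∈? fs
  ... | yes g∈ = g∈
  ... | no g∉ = ⊥-elim (clash (pigeonhole (s≤s le) (λ i → index (proj₁ (proj₂ (missed i))))))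
    where
    within : ∀ {f} → f ∈ˡ g ∷ fs → f ⊆ᵥ ws
    within (here refl) = g⊆
    within (there f∈) = fs⊆ f∈
    missed : ∀ i → ∃ λ t → t ∈ˡ ws × t ∉ₑ lookup (g ∷ fs) i
    missed i = missing uw (≤-reflexive (sym lw)) (lookup (g ∷ fs) i)
    clash : ¬ (∃ λ i → ∃ λ j → i <ᶠ j × index (proj₁ (proj₂ (missed i))) ≡ index (proj₁ (proj₂ (missed j))))
    clash (i , j , i<j , eq) with missed i | missed j
    ... | s , s∈ , s∉ | t , t∈ , t∉ =
      -- Both edges miss the same vertex; the second misses nothing else of `ws`, so it contains the
      -- first.
      <⇒≢ᶠ i<j (lookup-injective (unique-∷ g∉ uf) (edge-⊆ λ x∈ →
        misses-one uw (≤-reflexive lw) (within (∈-lookup j)) t∈ t∉ (within (∈-lookup i) x∈)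
          λ { refl → s∉ (subst (_∈ₑ _) (trans (lookup-index t∈) (trans (cong (lookup ws) (sym eq)) (sym (lookup-index s∈)))) x∈) }))

  -- Only the edges are prescribed: a rotation keeps them but may trade one vertex of the path for
  -- another.
  Endpoint : List E → V → Set
  Endpoint fs x = ∃ λ y → ∃ λ ws → Link x ws fs y × Unique ws

  CycleOfLength : ℕ → Set
  CycleOfLength l = ∃ λ u → ∃ λ v → ∃ λ f → ∃ λ vs → ∃ λ fs →
    Cycle u v f vs fs × Unique vs × Unique fs × length vs ≡ l

  ManyEndpoints : ℕ → List E → Set
  ManyEndpoints k fs = ∃ λ xs → Unique xs × All (Endpoint fs) xs × r ≤ length xs × (k < r → r < length xs)

  -- Collecting endpoints along a path.

  module Sweep (u₀ v₁ vₖ : V) (e₁ : E) (us : List V) (es : List E)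
    (u₀∈e₁ : u₀ ∈ₑ e₁) (v₁∈e₁ : v₁ ∈ₑ e₁) (u₀∉us : u₀ ∉ˡ us) (unique-us : Unique us) (unique-es : Unique es)
    (length-us : length us ≤ r) (last-endpoint : Endpoint es vₖ) where

    hits : List V → ℕ
    hits xs = length (filter (_∈ˢ? edge H e₁) xs)

    -- The endpoints collected after t steps, where x = vₜ, as = vₜ₋₁, …, v₁ and ae = eₜ, …, e₂. An outer
    -- one starts a path through e₁, …, eₜ ending at vₜ, so if it lies in eₜ₊₁, then vₜ is an endpoint.
    data Item (x : V) (as : List V) (ae : List E) (w : V) : Set where
      inner : w ∈ˡ as → Endpoint es w → Item x as ae w
      outer : w ∉ˡ us → Link w (w ∷ x ∷ as) (e₁ ∷ ae) x → Item x as ae w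

    item-step : ∀ {x y as ae e w} → x ∈ₑ e → y ∈ₑ e → Item x as ae w → Item y (x ∷ as) (e ∷ ae) w
    item-step x∈ y∈ (inner w∈ E) = inner (there w∈) E
    item-step {x} {y} {as} {ae} {e} {w} x∈ y∈ (outer w∉ Q) = outer w∉ (relabel
      (solve 4 (λ w x y a → (w ⊕ (x ⊕ a)) ⊕ y ⊜ w ⊕ (y ⊕ (x ⊕ a))) ↭-refl [ w ] [ x ] [ y ] as)
      (solve 3 (λ e e₁ a → e ⊕ ((e₁ ⊕ a) ⊕ id) ⊜ e₁ ⊕ (e ⊕ a)) ↭-refl [ e ] [ e₁ ] ae)
      (join Q (x∈ , y∈) (walk stop)))

    endpoint : ∀ {w y ws fs} → w ∉ˡ us → Link y ws fs vₖ → ws ↭ w ∷ us → fs ↭ es → Endpoint es y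
    endpoint w∉ Q p q = _ , _ , relabel p q Q , unique-∷ w∉ unique-us

    -- The last hypothesis is the invariant: of the `r` vertices of `e₁`, `v₁` accounts for the
    -- `suc`, those still ahead are the `hits`, and each of the others has put its own item into
    -- `L`. At the end `L` has at least `r - 1` members, and vₖ is one more endpoint.
    sweep : ∀ {x y e as ae rs re L} → Link x (x ∷ as) ae v₁ → x ∈ₑ e → y ∈ₑ e → Walk y rs re vₖ →
      (x ∷ as) ++ y ∷ rs ↭ us → e₁ ∷ ae ++ e ∷ re ↭ es →
      Unique L → All (Item x as ae) L → r ≤ suc (length L + hits (y ∷ rs)) →
      CycleOfLength (length us) ⊎ ManyEndpoints (length us) es
    sweep {x} {y} {e} {as} {ae} {rs} {re} {L} A x∈ y∈ R vp ep uL items count = by-cases R (y ∈ˢ? edge H e₁) (outsider? e us) count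
      where
      Goal = CycleOfLength (length us) ⊎ ManyEndpoints (length us) es

      in-us : ∀ {z} → z ∈ˡ (x ∷ as) ++ y ∷ rs → z ∈ˡ us
      in-us = ∈-resp-↭ vp

      unique-all : Unique ((x ∷ as) ++ y ∷ rs)
      unique-all = unique-resp-↭ (↭-sym vp) unique-us

      -- Items inside `us` are inner and lie in `as`, so neither `x` nor `y` has been collected yet.
      fresh : ∀ {z} → z ∈ˡ us → z ∉ˡ as → z ∉ˡ L
      fresh z∈us z∉as z∈L with All.lookup items z∈L
      ... | inner z∈as _ = z∉as z∈as
      ... | outer z∉us _ = z∉us z∈us

      outer-link : ∀ {w} → w ∉ˡ us → w ∈ˡ L → Link w (w ∷ x ∷ as) (e₁ ∷ ae) x
      outer-link w∉us w∈L with All.lookup items w∈L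
      ... | inner w∈as _ = ⊥-elim (w∉us (in-us (there (∈-++⁺ˡ w∈as))))
      ... | outer _ Q    = Q

      P? = _∈ˢ? edge H e₁

      at-least : filter P? (y ∷ []) ≡ [] → r ≤ suc (length L + hits (y ∷ [])) → r ≤ suc (length L)
      at-least eq = subst (λ l → r ≤ suc l) (trans (cong (λ l → length L + length l) eq) (+-identityʳ _))

      at-least′ : ∀ {zs} → filter P? (y ∷ zs) ≡ y ∷ filter P? zs →
        r ≤ suc (length L + hits (y ∷ zs)) → r ≤ suc (suc (length L) + hits zs)
      at-least′ {zs} eq = subst (λ l → r ≤ suc l) (trans (cong (λ l → length L + length l) eq) (+-suc _ _))

      x∉L : x ∉ˡ L
      x∉L = fresh (in-us (here refl)) (unique-head unique-all ∘ ∈-++⁺ˡ)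

      y∉prefix : y ∉ˡ x ∷ as
      y∉prefix = unique-head (unique-resp-↭ (shift y (x ∷ as) rs) unique-all) ∘ ∈-++⁺ˡ

      unique-x∷as : Unique (x ∷ as)
      unique-x∷as = unique-prefix (x ∷ as) unique-all

      next-vertices : (y ∷ x ∷ as) ++ rs ↭ us
      next-vertices = ↭-trans (↭-sym (shift y (x ∷ as) rs)) vp

      next-edges : e₁ ∷ (e ∷ ae) ++ re ↭ es
      next-edges = ↭-trans (prep e₁ (↭-sym (shift e ae re))) ep

      joined-edges : e ∷ (e₁ ∷ ae) ++ re ↭ es
      joined-edges = ↭-trans (solve 3 (λ e e₁ a → e ⊕ (e₁ ⊕ a) ⊜ e₁ ⊕ (e ⊕ a)) ↭-refl [ e ] [ e₁ ] (ae ++ re)) next-edges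

      y∉L : y ∉ˡ L
      y∉L = fresh (in-us (∈-++⁺ʳ (x ∷ as) (here refl))) (y∉prefix ∘ there)

      steps : All (Item y (x ∷ as) (e ∷ ae)) L
      steps = All.map (item-step x∈ y∈) items

      A′ : Link y (y ∷ x ∷ as) (e ∷ ae) v₁
      A′ = (y∈ , x∈) ◅ A

      -- The cycle runs from `x` back to `v₁`, over `e₁` to `y`, along the path to `vₖ`, and over
      -- `e` to `x`.
      close : y ∈ₑ e₁ → vₖ ∈ₑ e → Goal
      close y∈e₁ vₖ∈e = inj₁ (x , vₖ , e , us , es
        , (_ , relabel vp ↭-refl (join A (v₁∈e₁ , y∈e₁) (walk R)) , x∈ , vₖ∈e , joined-edges)
        , unique-us , unique-es , refl)

      -- w, x = vₖ₋₁, …, v₁ form a cycle closed by e = eₖ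
      close-at : ∀ {w} → rs ≡ [] → re ≡ [] → w ∉ˡ us → w ∈ₑ e → Link w (w ∷ x ∷ as) (e₁ ∷ ae) x → Goal
      close-at {w} refl refl w∉us w∈e Q = inj₁ (w , x , e , w ∷ x ∷ as , es
        , (_ , Q , w∈e , x∈ , ↭-trans (solve 3 (λ e e₁ a → e ⊕ (e₁ ⊕ a) ⊜ e₁ ⊕ (a ⊕ (e ⊕ id))) ↭-refl [ e ] [ e₁ ] ae) ep)
        , unique-∷ (w∉us ∘ in-us ∘ ∈-++⁺ˡ) unique-x∷as
        , unique-es , ↭-length (↭-trans (++-comm [ y ] (x ∷ as)) vp))

      endpoint-item : ∀ {w} → Item x as ae w → Endpoint es w
      endpoint-item (inner _ E) = E
      endpoint-item {w} (outer w∉ Q) = endpoint w∉ (join Q (x∈ , y∈) (walk R)) (prep w vp) joined-edges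

      by-cases : Walk y rs re vₖ → Dec (y ∈ₑ e₁) → (∃ λ w → w ∈ₑ e × w ∉ˡ us) ⊎ e ⊆ᵥ us →
        r ≤ suc (length L + hits (y ∷ rs)) → Goal
      by-cases stop (yes y∈e₁) _ _ = close y∈e₁ y∈
      by-cases stop (no y∉e₁) (inj₂ e⊆) count = inj₂ (y ∷ L , unique-∷ y∉L uL
        , last-endpoint ∷ All.map endpoint-item items , at-least (filter-reject P? y∉e₁) count
        , λ k<r → ⊥-elim (<-irrefl refl (≤-trans k<r (⊆ᵥ-size e⊆))))
      by-cases stop (no y∉e₁) (inj₁ (w , w∈e , w∉us)) count with w ∈? L | w ≟ᶠ u₀
      ... | yes w∈L | _        = close-at refl refl w∉us w∈e (outer-link w∉us w∈L)
      ... | no  _   | yes refl = close-at refl refl u₀∉us w∈e ((u₀∈e₁ , v₁∈e₁) ◅ reverse A)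
      ... | no  w∉L | no w≢u₀  = inj₂ (w ∷ y ∷ L
        , unique-∷ (λ { (here refl) → w∉us (in-us (∈-++⁺ʳ (x ∷ as) (here refl))) ; (there w∈L) → w∉L w∈L }) (unique-∷ y∉L uL)
        -- The path from `w` goes over `e` to `x`, back to `v₁` and over `e₁` to `u₀`. It drops `y`,
        -- here the last vertex, and needs `w` to differ from `u₀`.
        , (u₀ , _ , relabel ↭-refl next-edges (join ((w∈e , x∈) ◅ A) (v₁∈e₁ , u₀∈e₁) (walk stop)) , unique-w-u₀)
          ∷ last-endpoint ∷ All.map endpoint-item items
        , ≤-trans (at-least (filter-reject P? y∉e₁) count) (n≤1+n _)
        , λ _ → s≤s (at-least (filter-reject P? y∉e₁) count))
        where
        unique-w-u₀ : Unique ((w ∷ x ∷ as) ++ [ u₀ ])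
        unique-w-u₀ = unique-resp-↭ (++-comm [ u₀ ] (w ∷ x ∷ as)) (unique-∷
          (λ { (here u₀≡w) → w≢u₀ (sym u₀≡w) ; (there u₀∈) → u₀∉us (in-us (∈-++⁺ˡ u₀∈)) })
          (unique-∷ (w∉us ∘ in-us ∘ ∈-++⁺ˡ) unique-x∷as))
      by-cases (step a∈ b∈ R′) (no y∉e₁) _ count =
        sweep A′ a∈ b∈ R′ next-vertices next-edges uL steps
          (subst (λ l → r ≤ suc (length L + length l)) (filter-reject P? y∉e₁) count)
      -- Since `us` has at most `r` vertices, `e` contains all of it, in particular `vₖ`.
      by-cases (step a∈ b∈ R′) (yes y∈e₁) (inj₂ e⊆) count =
        close y∈e₁ (⊆ᵥ-covers e⊆ length-us (in-us (∈-++⁺ʳ (x ∷ as) (end∈ (walk R)))))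
      by-cases (step a∈ b∈ R′) (yes y∈e₁) (inj₁ (w , w∈e , w∉us)) count with w ∈? L
      -- As `w` already counts, `x` is collected for `y`: follow the path of `w` backwards from `x`
      -- to `w`, then take `e` to `y` and go on to `vₖ`.
      ... | yes w∈L = sweep A′ a∈ b∈ R′ next-vertices next-edges (unique-∷ x∉L uL)
        (inner (here refl) (endpoint w∉us (join (reverse (outer-link w∉us w∈L)) (w∈e , y∈) (walk R)) (prep w vp) joined-edges) ∷ steps)
        (at-least′ (filter-accept P? y∈e₁) count)
      -- The new path goes from `w` over `e` to `x`, back to `v₁`, and over `e₁` to `y`, where the
      -- next step finds it.
      ... | no  w∉L = sweep A′ a∈ b∈ R′ next-vertices next-edges (unique-∷ w∉L uL)
        (outer w∉us (relabel
          (solve 3 (λ w a y → (w ⊕ a) ⊕ y ⊜ w ⊕ (y ⊕ a)) ↭-refl [ w ] (x ∷ as) [ y ])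
          (prep e₁ (++-comm (e ∷ ae) []))
          (join ((w∈e , x∈) ◅ A) (v₁∈e₁ , y∈e₁) (walk stop))) ∷ steps)
        (at-least′ (filter-accept P? y∈e₁) count)

  -- The sweep starts at `v₁` with all vertices of `e₁` outside `us` as outer items, each with its
  -- one-edge path to `v₁`.
  endpoints-or-cycle : ∀ {u₀ us es vₖ} → 2 ≤ length us → length us ≤ r → Unique (u₀ ∷ us) → Unique es →
    Walk u₀ us es vₖ → CycleOfLength (length us) ⊎ ManyEndpoints (length us) es
  endpoints-or-cycle (s≤s ()) _ _ _ (step _ _ stop)
  endpoints-or-cycle {u₀} {us@(v₁ ∷ us′)} {es} 2≤ ≤r uu ue P@(step {e = e₁} u₀∈ v₁∈ (step x∈ y∈ R)) =
    sweep (walk stop) x∈ y∈ R ↭-refl ↭-refl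
      (Unique.filter⁺ out? (elements-unique (edge H e₁)))
      (All.tabulate λ w∈ → let (w∈e₁ , w∉us) = ∈-filter⁻ out? w∈ in
        outer w∉us ((∈-elements⁻ w∈e₁ , v₁∈) ◅ walk stop))
      (subst₂ _≤_ (length-vertices e₁) (cong suc (length-++ (filter out? (vertices e₁))))
        (⊆-length (elements-unique (edge H e₁)) sub))
    where
    open Sweep u₀ v₁ _ e₁ us es u₀∈ v₁∈ (unique-head uu) (unique-tail uu) ue ≤r (_ , _ , reverse (walk P) , uu)
    out? : ∀ w → Dec (w ∉ˡ us)
    out? w = ¬? (w ∈? us)
    sub : vertices e₁ ⊆ v₁ ∷ filter out? (vertices e₁) ++ filter (_∈ˢ? edge H e₁) us′
    sub {w} w∈ with w ∈? us
    ... | yes (here refl)  = here refl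
    ... | yes (there w∈us′) = there (∈-++⁺ʳ (filter out? (vertices e₁)) (∈-filter⁺ (_∈ˢ? edge H e₁) w∈us′ (∈-elements⁻ w∈)))
    ... | no  w∉us = there (∈-++⁺ˡ (∈-filter⁺ out? w∈ w∉us))

-- Consequences of the maximality of `k`.

module Longest {n : ℕ} (H : Hypergraph n) {r : ℕ} (uniform : Uniform r H) (k : ℕ)
  (maximal : ∀ j → BergePath H j → j ≤ k) where

  open Paths H
  open UniformEdges H uniform

  private
    variable
      u v w x y z : V
      e f g : E
      vs ws : List V
      es fs : List E

  bounded : Link u ws es v → Unique ws → Unique es → length es ≤ k
  bounded (_ , fs , P , p , q) uw ue = subst (_≤ k) (↭-length q)
    (maximal _ (proj₁ (toBerge P (unique-resp-↭ (↭-sym p) uw) (unique-resp-↭ (↭-sym q) ue))))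

  too-long : Link u ws es v → Unique ws → Unique es → length es ≢ suc k
  too-long P uw ue eq = <-irrefl refl (subst (_≤ k) eq (bounded P uw ue))

  OnLongest : E → Set
  OnLongest e = ∃ λ u → ∃ λ ws → ∃ λ es → ∃ λ v → Link u ws es v × Unique ws × Unique es × e ∈ˡ es × length es ≡ k

  pathNumber : OnLongest e → PathNumber H e k
  pathNumber {e} (_ , _ , _ , _ , (_ , _ , P , p , q) , uw , ue , e∈ , le) =
    uses (trans (↭-length q) le) (toBerge P (unique-resp-↭ (↭-sym p) uw) (unique-resp-↭ (↭-sym q) ue)) (∈-resp-↭ (↭-sym q) e∈)
    , λ j P _ → maximal j P
    where
    uses : ∀ {fs l} → l ≡ k → (Σ (BergePath H l) λ P → ∀ {e} → e ∈ˡ fs → UsesEdge P e) →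
      e ∈ˡ fs → Σ (BergePath H k) λ P → UsesEdge P e
    uses refl (B , used) e∈ = B , used e∈

  Sizes : ℕ → ℕ → Set
  Sizes s t = (k ≡ r × s ≡ r × t ≤ r) ⊎ (k ≡ r × suc r ≤ s × t ≤ suc r) ⊎ (k < r × suc r ≤ s × t ≤ k)

  -- Here `xs` lists `S`, while `fs` need only contain every edge meeting `S`: its length is an
  -- upper bound for the size of N(S). `Sizes` encodes alternatives (i) to (iii).
  Outcome : Set
  Outcome = ∃ λ xs → ∃ λ fs → Unique xs × (∀ {x e} → x ∈ˡ xs → x ∈ₑ e → e ∈ˡ fs) × (∀ {e} → e ∈ˡ fs → OnLongest e) ×
    Sizes (length xs) (length fs)

  endpoint-onLongest : Endpoint es x → Unique es → length es ≡ k → e ∈ˡ es → OnLongest e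
  endpoint-onLongest (_ , _ , P , uw) ue le e∈ = _ , _ , _ , _ , P , uw , ue , e∈ , le

  endpoint-outcome : 0 < r → k ≤ r → Unique es → length es ≡ k → (many : ManyEndpoints k es) →
    (∀ {x e} → x ∈ˡ proj₁ many → x ∈ₑ e → e ∈ˡ es) → Outcome
  endpoint-outcome {es} 0<r k≤r ue le (xs , ux , ends , r≤ , r<) closed =
    xs , es , ux , closed , on-longest xs ends (≤-trans 0<r r≤) , sizes (m≤n⇒m<n∨m≡n k≤r) (m≤n⇒m<n∨m≡n r≤)
    where
    on-longest : ∀ xs → All (Endpoint es) xs → 0 < length xs → ∀ {e} → e ∈ˡ es → OnLongest e
    on-longest (_ ∷ _) (end ∷ _) _ = endpoint-onLongest end ue le
    sizes : k < r ⊎ k ≡ r → r < length xs ⊎ r ≡ length xs → Sizes (length xs) (length es)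
    sizes (inj₁ k<r)  _         = inj₂ (inj₂ (k<r , r< k<r , ≤-reflexive le))
    sizes (inj₂ refl) (inj₁ r<) = inj₂ (inj₁ (refl , r< , ≤-trans (≤-reflexive le) (n≤1+n _)))
    sizes (inj₂ refl) (inj₂ eq) = inj₁ (refl , sym eq , ≤-reflexive le)

  -- Edges at the ends of longest paths, and the case k < r.

  edge-at-end : Link u ws es v → Unique ws → Unique es → length es ≡ k → u ∈ₑ g → g ∉ˡ es → g ⊆ᵥ ws
  edge-at-end {ws = ws} {g = g} P uw ue le u∈ g∉ with outsider? g ws
  ... | inj₂ g⊆ = g⊆
  ... | inj₁ (y , y∈ , y∉) = ⊥-elim (too-long ((y∈ , u∈) ◅ P) (unique-∷ y∉ uw) (unique-∷ g∉ ue) (cong suc le))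

  -- An edge `g` off the path would lie in the `k + 1` vertices of the path, at most `r` many, and
  -- so contain all of them. The first edge differs from `g`, hence has a vertex `y` outside;
  -- starting at `y` over that edge and returning over `g` from the last vertex to the old start
  -- uses `k + 1` edges.
  end-edges-short : 2 ≤ k → k < r → Unique es → length es ≡ k → Endpoint es x → x ∈ₑ g → g ∈ˡ es
  end-edges-short {es} {g = g} 2≤k k<r ue le (v , ws , P@(ws′ , fs , W , p , q) , uw) x∈ with g ∈? es
  ... | yes g∈ = g∈
  ... | no  g∉ = ⊥-elim (absurd W p q)
    where
    g⊆ : g ⊆ᵥ ws
    g⊆ = edge-at-end P uw ue le x∈ g∉
    ws≤r : length ws ≤ r
    ws≤r = subst (_≤ r) (sym (trans (link-length P) (cong suc le))) k<r
    absurd : ∀ {u ws′ fs} → Walk u ws′ fs v → u ∷ ws′ ↭ ws → fs ↭ es → ⊥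
    absurd stop p q = <-irrefl refl (≤-trans (≤-trans (s≤s z≤n) 2≤k) (≤-reflexive (trans (sym le) (sym (↭-length q)))))
    absurd {u} (step {e = e₁} {x = x₁} {vs = vs} {es = fs} u∈ x₁∈ W) p q with outsider? e₁ ws
    ... | inj₂ e₁⊆ = g∉ (∈-resp-↭ q (here (⊆ᵥ-same g⊆ e₁⊆ ws≤r)))
    ... | inj₁ (y , y∈ , y∉) = too-long
      (relabel (prep y (++-comm (x₁ ∷ vs) [ u ])) (prep g (++-comm (e₁ ∷ fs) []))
        (join ((y∈ , x₁∈) ◅ walk W) (covered (end∈ P) , covered (∈-resp-↭ p (here refl))) (walk stop)))
      (unique-∷ (y∉ ∘ ∈-resp-↭ p) (unique-resp-↭ (↭-sym p) uw))
      (unique-∷ (g∉ ∘ ∈-resp-↭ q) (unique-resp-↭ (↭-sym q) ue))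
      (cong suc (trans (↭-length q) le))
      where
      covered : ∀ {z} → z ∈ˡ ws → z ∈ₑ g
      covered = ⊆ᵥ-covers g⊆ ws≤r

  -- Every vertex of a cycle edge is an endpoint. One off the cycle is put before the cycle opened
  -- at that edge; one on it starts the opened cycle, whose closing edge leads to a vertex outside
  -- because `k < r`. Two distinct edges together have at least `r + 1` vertices.
  cycle-endpoints-short : 2 ≤ k → k < r → Cycle u v f vs fs → Unique vs → Unique fs → length vs ≡ k → ManyEndpoints k fs
  cycle-endpoints-short {u} {v} {f} {vs} {fs} 2≤k k<r C@(_ , _ , _ , _ , q) uv uf lv
    with other-neighbour uv uf (subst (2 ≤_) (sym lv) 2≤k) C
  ... | _ , e , (_ , _ , _ , _ , q′) , f≢e , _ with outsider? e (vertices f)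
  ...   | inj₂ e⊆ = ⊥-elim (f≢e (sym (edge-⊆ (∈-elements⁻ ∘ e⊆))))
  ...   | inj₁ (y , y∈e , y∉f) = y ∷ vertices f , unique-∷ y∉f (elements-unique (edge H f))
      , endpoint (∈-resp-↭ q′ (here refl)) y∈e ∷ All.tabulate (λ z∈ → endpoint (∈-resp-↭ q (here refl)) (∈-elements⁻ z∈))
      , ≤-trans (n≤1+n r) size , λ _ → size
    where
    size : r < suc (length (vertices f))
    size = s≤s (≤-reflexive (sym (length-vertices f)))
    endpoint : ∀ {h z} → h ∈ˡ fs → z ∈ₑ h → Endpoint fs z
    endpoint {h} {z} h∈ z∈ with z ∈? vs
    ... | no z∉ with cut-edge h∈ C
    ...   | _ , _ , _ , P , a∈ , _ , s = _ , _ , relabel ↭-refl s ((z∈ , a∈) ◅ P) , unique-∷ z∉ uv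
    endpoint {h} {z} h∈ z∈ | yes z∈vs with cut-vertex z∈vs C
    ...   | _ , d , _ , P , _ , b∈ , s with outsider? d vs
    ...     | inj₂ d⊆ = ⊥-elim (<-irrefl refl (≤-trans k<r (subst (r ≤_) lv (⊆ᵥ-size d⊆))))
    ...     | inj₁ (w , w∈ , w∉) = _ , _ , relabel (++-comm vs [ w ]) (↭-trans (prep d (++-comm _ [])) s) (join P (b∈ , w∈) (walk stop))
                                 , unique-∷ w∉ uv

  short-outcome : 2 ≤ k → k < r → BergePath H k → Outcome
  short-outcome 2≤k k<r B with fromBerge B
  ... | u₀ , us , es , _ , W , uu , ue , le =
    [ (λ (_ , _ , _ , vs , fs , C , uv , uf , lv) →
         conclude uf (trans (sym (cycle-length C)) (trans lv length-us)) (cycle-endpoints-short 2≤k k<r C uv uf (trans lv length-us)))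
    , conclude ue le ∘ subst (λ l → ManyEndpoints l es) length-us
    ]′ (endpoints-or-cycle (subst (2 ≤_) (sym length-us) 2≤k) (subst (_≤ r) (sym length-us) (<⇒≤ k<r)) uu ue W)
    where
    length-us : length us ≡ k
    length-us = trans (cong pred (link-length (walk W))) le
    conclude : ∀ {fs} → Unique fs → length fs ≡ k → ManyEndpoints k fs → Outcome
    conclude uf lf many = endpoint-outcome (≤-trans (s≤s z≤n) k<r) (<⇒≤ k<r) uf lf many
      (λ x∈ → end-edges-short 2≤k k<r uf lf (All.lookup (proj₁ (proj₂ (proj₂ many))) x∈))

-- The case k = r.

module LongestEqual {n : ℕ} (H : Hypergraph n) {r : ℕ} (uniform : Uniform r H) (3≤r : 3 ≤ r)
  (maximal : ∀ j → BergePath H j → j ≤ r) where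

  open Paths H
  open UniformEdges H uniform
  open Longest H uniform r maximal

  private
    variable
      u v w x y z : V
      e f g : E
      vs ws : List V
      es fs : List E

  2≤r : 2 ≤ r
  2≤r = <⇒≤ 3≤r

  -- A set of `r + 1` vertices has only `r + 1` subsets of size `r`, so `fs` already contains every
  -- edge inside `vs`.
  full-outcome : Unique vs → length vs ≡ suc r → Unique fs → length fs ≡ suc r → (∀ {f} → f ∈ˡ fs → f ⊆ᵥ vs) →
    (∀ {x g} → x ∈ˡ vs → x ∈ₑ g → g ⊆ᵥ vs) → (∀ {f} → f ∈ˡ fs → OnLongest f) → Outcome
  full-outcome uv lv uf lf fs⊆ closed on =
    _ , _ , uv , (λ x∈ x∈g → all-subsets uv lv fs⊆ uf (≤-reflexive (trans lv (sym lf))) (closed x∈ x∈g)) , on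
    , inj₂ (inj₁ (refl , ≤-reflexive (sym lv) , ≤-reflexive lf))

  cycle-path : Cycle u v f vs fs → Unique fs → ∃ λ es → Link u vs es v × f ∷ es ↭ fs × Unique es × f ∉ˡ es × length vs ≡ suc (length es)
  cycle-path (es , P , _ , _ , q) uf = es , P , q , unique-tail uf′ , unique-head uf′ , link-length P
    where uf′ = unique-resp-↭ (↭-sym q) uf

  -- An edge from the cycle to an outside vertex would extend the cycle, opened at that edge or at
  -- the common vertex, to `r + 1` edges. Opening at a neighbouring edge puts a given cycle edge on
  -- a path of length `r`.
  big-cycle-outcome : CycleOfLength (suc r) → Outcome
  big-cycle-outcome (u , v , f , vs , fs , C , uv , uf , lv) =
    full-outcome uv lv uf (trans (sym (cycle-length C)) lv) fs⊆ closed on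
    where
    closed : ∀ {x g} → x ∈ˡ vs → x ∈ₑ g → g ⊆ᵥ vs
    closed {x} {g} x∈ x∈g with outsider? g vs
    ... | inj₂ g⊆ = g⊆
    ... | inj₁ (y , y∈ , y∉) with g ∈? fs
    ...   | yes g∈ with cut-edge g∈ C
    ...     | _ , _ , es , P , a∈ , _ , q =
      ⊥-elim (too-long ((y∈ , a∈) ◅ P) (unique-∷ y∉ uv) (unique-resp-↭ (↭-sym q) uf) (trans (sym (link-length P)) lv))
    closed {x} {g} x∈ x∈g | inj₁ (y , y∈ , y∉) | no g∉ with cut-vertex x∈ C
    ...     | _ , _ , C′ with cycle-path C′ uf
    ...       | es , P , q , ue , _ , l = ⊥-elim (too-long ((y∈ , x∈g) ◅ P) (unique-∷ y∉ uv)
        (unique-∷ (g∉ ∘ ∈-resp-↭ q ∘ there) ue) (trans (sym l) lv))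
    fs⊆ : ∀ {h} → h ∈ˡ fs → h ⊆ᵥ vs
    fs⊆ h∈ with cut-edge h∈ C
    ... | _ , _ , _ , P , a∈ , _ = closed (start∈ P) a∈
    on : ∀ {h} → h ∈ˡ fs → OnLongest h
    on h∈ with cut-edge h∈ C
    ... | a , b , C′ with other-neighbour uv uf (subst (2 ≤_) (sym lv) (s≤s (≤-trans (s≤s z≤n) 3≤r))) C′
    ...   | _ , _ , C″ , h≢d , _ with cycle-path C″ uf
    ...     | es , P , q , ue , _ , l with ∈-resp-↭ (↭-sym q) h∈
    ...       | here h≡d  = ⊥-elim (h≢d h≡d)
    ...       | there h∈es = _ , _ , es , _ , P , uv , ue , h∈es , suc-injective (trans (sym l) lv)

  ends-distinct : Link u ws es v → Unique ws → 2 ≤ length ws → u ≢ v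
  ends-distinct (_ , _ , stop , p , _) uw 2≤ refl = <-irrefl refl (subst (2 ≤_) (sym (↭-length p)) 2≤)
  ends-distinct (_ , _ , step _ _ P , p , _) uw 2≤ refl = unique-head (unique-resp-↭ (↭-sym p) uw) (end∈ (walk P))

  -- An edge g off an r-cycle with a vertex w outside it forces everything near the cycle into its r vertices and w.
  pendant-outcome : Cycle u v f vs fs → Unique vs → Unique fs → length vs ≡ r → g ∉ˡ fs →
    z ∈ˡ vs → z ∈ₑ g → w ∈ₑ g → w ∉ˡ vs → Outcome
  pendant-outcome {vs = vs} {fs = fs} {g = g} {z = z} {w = w} C uv uf lv g∉ z∈ z∈g w∈g w∉
    with cut-vertex z∈ C
  ... | a , f , Cₐ with other-neighbour uv uf (subst (2 ≤_) (sym lv) 2≤r) Cₐ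
  ...   | b , e , Cᵦ , f≢e , _ with cycle-path Cₐ uf | cycle-path Cᵦ uf
  ...     | es , P , q , ue , f∉es , l | es′ , P′ , q′ , ue′ , e∉es′ , l′ =
    full-outcome (unique-∷ w∉ uv) (cong suc lv) (unique-∷ g∉ uf) (cong suc (trans (sym (cycle-length C)) lv)) within closed on
    where
    2≤vs : 2 ≤ length vs
    2≤vs = subst (2 ≤_) (sym lv) 2≤r

    -- Otherwise `w`, `g`, the cycle opened at `h`, and then `h` to an outside vertex form a path
    -- with `r + 1` edges.
    closing⊆ : ∀ {a b h w} → Cycle a b h vs fs → a ∈ₑ g → w ∈ₑ g → w ∉ˡ vs → h ⊆ᵥ w ∷ vs
    closing⊆ {h = h} {w} D@(_ , _ , _ , b∈h , _) a∈g w∈g w∉ with outsider? h (w ∷ vs)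
    ... | inj₂ h⊆ = h⊆
    ... | inj₁ (y , y∈ , y∉) with cycle-path D uf
    ...   | es , P , q , ue , h∉es , l = ⊥-elim (too-long
      (relabel (++-comm (w ∷ vs) [ y ]) (prep h (++-comm (g ∷ es) [])) (join ((w∈g , a∈g) ◅ P) (b∈h , y∈) (walk stop)))
      (unique-∷ y∉ (unique-∷ w∉ uv))
      (unique-∷ (λ { (here refl) → g∉ (∈-resp-↭ q (here refl)) ; (there h∈) → h∉es h∈ }) (unique-∷ (g∉ ∘ ∈-resp-↭ q ∘ there) ue))
      (cong suc (trans (sym l) lv)))

    -- With a second outside vertex `w′` in `g`, both cycle edges at `z` would lie in `w ∷ vs` and
    -- in `w′ ∷ vs`, hence in the `r` vertices `vs`, and coincide.
    g⊆ : g ⊆ᵥ w ∷ vs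
    g⊆ with outsider? g (w ∷ vs)
    ... | inj₂ g⊆ = g⊆
    ... | inj₁ (w′ , w′∈ , w′∉) = ⊥-elim (f≢e (⊆ᵥ-same (both Cₐ) (both Cᵦ) (≤-reflexive lv)))
      where
      both : ∀ {b h} → Cycle z b h vs fs → h ⊆ᵥ vs
      both D x∈ with closing⊆ D z∈g w∈g w∉ x∈ | closing⊆ D z∈g w′∈ (w′∉ ∘ there) x∈
      ... | there x∈vs | _ = x∈vs
      ... | here _ | there x∈vs = x∈vs
      ... | here refl | here refl = ⊥-elim (w′∉ (here refl))

    meets : ∀ {a b} → a ∈ˡ vs → b ∈ˡ vs → a ≢ b → a ∈ₑ g ⊎ b ∈ₑ g
    meets {a} a∈ b∈ a≢b with a ∈ˢ? edge H g
    ... | yes a∈g = inj₁ a∈g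
    ... | no  a∉g = inj₂ (misses-one (unique-∷ w∉ uv) (≤-reflexive (cong suc lv)) g⊆ (there a∈) a∉g (there b∈) a≢b)

    within : ∀ {h} → h ∈ˡ g ∷ fs → h ⊆ᵥ w ∷ vs
    within (here refl) = g⊆
    within (there h∈) with cut-edge h∈ C
    ... | _ , _ , D@(_ , Q , _) =
      [ (λ a∈g → closing⊆ D a∈g w∈g w∉) , (λ b∈g → closing⊆ (cycle-reverse D) b∈g w∈g w∉) ]′
        (meets (start∈ Q) (end∈ Q) (ends-distinct Q uv 2≤vs))

    closed : ∀ {x h} → x ∈ˡ w ∷ vs → x ∈ₑ h → h ⊆ᵥ w ∷ vs
    closed {x} {h} x∈ x∈h with h ∈? (g ∷ fs) | outsider? h (w ∷ vs)
    ... | yes h∈ | _ = within h∈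
    ... | no _ | inj₂ h⊆ = h⊆
    closed {h = h} (here refl) x∈h | no h∉ | inj₁ (y , y∈ , y∉) = ⊥-elim (too-long ((y∈ , x∈h) ◅ ((w∈g , z∈g) ◅ P))
      (unique-∷ y∉ (unique-∷ w∉ uv))
      (unique-∷ (λ { (here refl) → h∉ (here refl) ; (there h∈) → h∉ (there (∈-resp-↭ q (there h∈))) })
        (unique-∷ (g∉ ∘ ∈-resp-↭ q ∘ there) ue))
      (cong suc (trans (sym l) lv)))
    -- The two cycle neighbours of `x` differ as `r ≥ 3`, so one of them lies in `g`. Then `y`, `h`,
    -- around the cycle from `x` to that neighbour, `g`, `w` is too long.
    closed {h = h} (there x∈) x∈h | no h∉ | inj₁ (y , y∈ , y∉) with cut-vertex x∈ C
    ... | c , _ , D with other-neighbour uv uf 2≤vs D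
    ...   | c′ , _ , D′ , _ , distinct = ⊥-elim ([ absurd D , absurd D′ ]′
        (meets (end∈ (proj₁ (proj₂ D))) (end∈ (proj₁ (proj₂ D′))) (distinct (subst (3 ≤_) (sym lv) 3≤r))))
      where
      absurd : ∀ {c d} → Cycle _ c d vs fs → ¬ (c ∈ₑ g)
      absurd D c∈g with cycle-path D uf
      ... | es , Q , q , ue , _ , l = too-long
        (relabel (prep y (++-comm vs [ w ])) (prep g (++-comm (h ∷ es) [])) (join ((y∈ , x∈h) ◅ Q) (c∈g , w∈g) (walk stop)))
        (unique-∷ y∉ (unique-∷ w∉ uv))
        (unique-∷ (λ { (here refl) → h∉ (here refl) ; (there g∈) → g∉ (∈-resp-↭ q (there g∈)) })
          (unique-∷ (h∉ ∘ there ∘ ∈-resp-↭ q ∘ there) ue))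
        (cong suc (trans (sym l) lv))

    through : ∀ {b d es h} → Link z vs es b → d ∷ es ↭ fs → Unique es → length vs ≡ suc (length es) → h ∈ˡ g ∷ es → OnLongest h
    through Q q ue l h∈ = _ , _ , _ , _ , (w∈g , z∈g) ◅ Q , unique-∷ w∉ uv
      , unique-∷ (g∉ ∘ ∈-resp-↭ q ∘ there) ue , h∈ , trans (sym l) lv

    -- The path from `w` over `g` and around the cycle omits one cycle edge at `z`; the two
    -- directions omit different ones.
    on : ∀ {h} → h ∈ˡ g ∷ fs → OnLongest h
    on (here refl) = through P q ue l (here refl)
    on (there h∈) with ∈-resp-↭ (↭-sym q) h∈
    ... | there h∈es = through P q ue l (there h∈es)
    ... | here refl with ∈-resp-↭ (↭-sym q′) h∈
    ...   | here f≡e   = ⊥-elim (f≢e f≡e)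
    ...   | there f∈es = through P′ q′ ue′ l′ (there f∈es)

  cycle-outcome : CycleOfLength r → Outcome
  cycle-outcome (u , v , f , vs , fs , C , uv , uf , lv)
    with any? (λ g → ¬? (g ∈? fs) ×-dec any? (λ x → (x ∈? vs) ×-dec (x ∈ˢ? edge H g)))
  ... | no none = vs , fs , uv
    , (λ {x} {e} x∈ x∈e → decidable-stable (e ∈? fs) (λ e∉ → none (e , e∉ , x , x∈ , x∈e)))
    , on , inj₁ (refl , lv , ≤-reflexive (trans (sym (cycle-length C)) lv))
    where
    pendant : ∀ {a b d} → Cycle a b d vs fs → (∃ λ w → w ∈ₑ d × w ∉ˡ vs) → ∀ {h} → h ∈ˡ fs → OnLongest h
    pendant (es , P , a∈ , _ , q) (w , w∈ , w∉) h∈ = _ , _ , _ , _ , relabel ↭-refl q ((w∈ , a∈) ◅ P)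
      , unique-∷ w∉ uv , uf , h∈ , trans (sym (↭-length q)) (trans (sym (link-length P)) lv)
    -- Two different edges cannot both fill `vs`, so `f` or `e` leaves the cycle; opening there and
    -- prepending an outside vertex uses all cycle edges.
    on : ∀ {h} → h ∈ˡ fs → OnLongest h
    on with outsider? f vs | other-neighbour uv uf (subst (2 ≤_) (sym lv) 2≤r) C
    ... | inj₁ out | _ = pendant C out
    ... | inj₂ f⊆ | _ , e , C′ , f≢e , _ with outsider? e vs
    ...   | inj₁ out = pendant C′ out
    ...   | inj₂ e⊆ = ⊥-elim (f≢e (⊆ᵥ-same f⊆ e⊆ (≤-reflexive lv)))
  ... | yes (g , g∉ , z , z∈ , z∈g) with outsider? g vs
  ...   | inj₁ (w , w∈g , w∉) = pendant-outcome C uv uf lv g∉ z∈ z∈g w∈g w∉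
  ...   | inj₂ g⊆ with outsider? f vs | C
  ...     | inj₂ f⊆ | _ , _ , _ , _ , q =
    ⊥-elim (g∉ (subst (_∈ˡ fs) (⊆ᵥ-same f⊆ g⊆ (≤-reflexive lv)) (∈-resp-↭ q (here refl))))
  -- The edge `g` fills `vs`, so it can replace `f` in the cycle; now `f` is the edge off the cycle
  -- with an outside vertex.
  ...     | inj₁ (w , w∈f , w∉) | es , P , u∈f , v∈f , q = pendant-outcome {f = g} (es , P , covered (start∈ P) , covered (end∈ P) , ↭-refl) uv
      (unique-∷ (g∉ ∘ ∈-resp-↭ q ∘ there) (unique-tail uf′)) lv
      (λ { (here refl) → g∉ (∈-resp-↭ q (here refl)) ; (there f∈es) → unique-head uf′ f∈es })
      (start∈ P) u∈f w∈f w∉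
    where
    uf′ = unique-resp-↭ (↭-sym q) uf
    covered : ∀ {x} → x ∈ˡ vs → x ∈ₑ g
    covered = ⊆ᵥ-covers g⊆ (≤-reflexive lv)

  -- If `g` contains the last vertex `v`, it closes the whole path. Otherwise `g` misses only `v`
  -- among the path vertices, so it contains the neighbour of `v` and closes the path without `v`.
  new-edge-cycle : Endpoint es x → Unique es → length es ≡ r → x ∈ₑ g → g ∉ˡ es → CycleOfLength r ⊎ CycleOfLength (suc r)
  new-edge-cycle {es = es} {x = x} {g = g} (v , ws , P , uw) ue le x∈g g∉ with v ∈ˢ? edge H g
  ... | yes v∈g = inj₂ (_ , _ , g , ws , g ∷ es , (es , P , x∈g , v∈g , ↭-refl) , uw , unique-∷ g∉ ue , lw)
    where lw = trans (link-length P) (cong suc le)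
  ... | no v∉g = inj₁ (shorten (reverse P))
    where
    lw = trans (link-length P) (cong suc le)
    g⊆ : g ⊆ᵥ ws
    g⊆ = edge-at-end P uw ue le x∈g g∉
    shorten : Link v ws es x → CycleOfLength r
    shorten (_ , _ , stop , _ , _) = ⊥-elim (v∉g x∈g)
    shorten (_ , _ , step {x = y} {vs = vs} {es = fs} v∈ y∈ W , p , q) =
      y , x , g , y ∷ vs , g ∷ fs
      , (fs , walk W , misses-one uw (≤-reflexive lw) g⊆ (end∈ P) v∉g (∈-resp-↭ p (there (here refl))) (λ v≡y → unique-head uw′ (here v≡y))
        , x∈g , ↭-refl)
      , unique-tail uw′ , unique-∷ (g∉ ∘ ∈-resp-↭ q ∘ there) (unique-tail (unique-resp-↭ (↭-sym q) ue))
      , suc-injective (trans (↭-length p) lw)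
      where uw′ = unique-resp-↭ (↭-sym p) uw

  equal-outcome : BergePath H r → Outcome
  equal-outcome B with fromBerge B
  ... | u₀ , us , es , _ , W , uu , ue , le =
    [ cycle-outcome ∘ subst CycleOfLength length-us , conclude ∘ subst (λ l → ManyEndpoints l es) length-us ]′
      (endpoints-or-cycle (subst (2 ≤_) (sym length-us) 2≤r) (≤-reflexive length-us) uu ue W)
    where
    length-us : length us ≡ r
    length-us = trans (cong pred (link-length (walk W))) le
    conclude : ManyEndpoints r es → Outcome
    conclude many@(xs , _ , ends , _)
      with any? (λ g → ¬? (g ∈? es) ×-dec any? (λ x → (x ∈? xs) ×-dec (x ∈ˢ? edge H g)))
    ... | yes (g , g∉ , x , x∈ , x∈g) =
      [ cycle-outcome , big-cycle-outcome ]′ (new-edge-cycle (All.lookup ends x∈) ue le x∈g g∉)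
    ... | no none = endpoint-outcome (≤-trans (s≤s z≤n) 3≤r) ≤-refl ue le many
      (λ {x} {e} x∈ x∈e → decidable-stable (e ∈? es) (λ e∉ → none (e , e∉ , x , x∈ , x∈e)))

-- From lists to vertex sets and good sets.

theorem3p7 : ∀ (r n : ℕ) (H : Hypergraph n) (k : ℕ) →
    3 ≤ r → Uniform r H → Connected H → LongestPathLength H k → 1 < k → k ≤ r →
    (∃ λ (S : Subset n) → Nonempty S × (∀ e → e ∈ N H S → PathNumber H e k) ×
    (  (k ≡ r × ∣ S ∣ ≡ r × ∣ N H S ∣ ≤ r)
    ⊎ (k ≡ r × suc r ≤ ∣ S ∣ × ∣ N H S ∣ ≤ suc r)
    ⊎ ((1 < k × k < r) × suc r ≤ ∣ S ∣ × ∣ N H S ∣ ≤ k)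
    ⊎ (suc ∣ S ∣ ≡ r × ∣ N H S ∣ ≡ 1)))
    × (∃ λ (S : Subset n) → GoodSet H r k S)
theorem3p7 r n H k 3≤r uniform _ (B , maximal) 1<k k≤r = conclude (outcome (m≤n⇒m<n∨m≡n k≤r))
  where
  open Longest H uniform k maximal

  outcome : k < r ⊎ k ≡ r → Outcome
  outcome (inj₁ k<r)  = short-outcome 1<k k<r B
  outcome (inj₂ refl) = LongestEqual.equal-outcome H uniform 3≤r maximal B

  choose-pred : r choose (r ∸ 1) ≡ r
  choose-pred = trans (nCk≡nC[n∸k] (m∸n≤m r 1)) (trans (cong (r choose_) (m∸[m∸n]≡n 1≤r)) (nC1≡n r))
    where 1≤r = ≤-trans (s≤s z≤n) 3≤r

  positive : ∀ {xs : List (Fin n)} → 3 ≤ length xs → ∃ λ x → x ∈ˡ xs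
  positive {x ∷ _} _ = x , here refl

  conclude : Outcome → _
  conclude (xs , fs , ux , closed , on , sizes) =
    (S , nonempty sizes , pathNumbers , options sizes) , (S , nonempty sizes , pathNumbers , bound sizes)
    where
    S : Subset n
    S = fromList xs

    ∣S∣≡ : ∣ S ∣ ≡ length xs
    ∣S∣≡ = ∣fromList∣ ux

    N⊆fs : ∀ {e} → e ∈ N H S → e ∈ˡ fs
    N⊆fs e∈ with ∈-tabulate⁻ (λ i → nonempty? (edge H i ∩ S)) e∈
    ... | x , x∈ with x∈p∩q⁻ _ _ x∈
    ...   | x∈e , x∈S = closed (∈-fromList⁻ {xs = xs} x∈S) x∈e

    ∣N∣≤ : ∀ {t} → length fs ≤ t → ∣ N H S ∣ ≤ t
    ∣N∣≤ = ≤-trans (∣∣≤length (N H S) N⊆fs)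

    pathNumbers : ∀ e → e ∈ N H S → PathNumber H e k
    pathNumbers e e∈ = pathNumber (on (N⊆fs e∈))

    nonempty : Sizes (length xs) (length fs) → Nonempty S
    nonempty sizes = let (x , x∈) = positive {xs} (≤-trans 3≤r (at-least-r sizes)) in x , ∈-fromList⁺ {xs = xs} x∈
      where
      at-least-r : Sizes (length xs) (length fs) → r ≤ length xs
      at-least-r (inj₁ (_ , eq , _))        = ≤-reflexive (sym eq)
      at-least-r (inj₂ (inj₁ (_ , le , _))) = <⇒≤ le
      at-least-r (inj₂ (inj₂ (_ , le , _))) = <⇒≤ le

    options : Sizes (length xs) (length fs) → _
    options (inj₁ (k≡r , s≡r , t≤))        = inj₁ (k≡r , trans ∣S∣≡ s≡r , ∣N∣≤ t≤)
    options (inj₂ (inj₁ (k≡r , r<s , t≤))) = inj₂ (inj₁ (k≡r , subst (r <_) (sym ∣S∣≡) r<s , ∣N∣≤ t≤))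
    options (inj₂ (inj₂ (k<r , r<s , t≤))) = inj₂ (inj₂ (inj₁ ((1<k , k<r) , subst (r <_) (sym ∣S∣≡) r<s , ∣N∣≤ t≤)))

    -- At k = r the factor C(r, r - 1) / r is 1, so a good set needs only as many vertices as edges
    -- meeting it.
    bound-equal : k ≡ r → length fs ≤ length xs → Bound r k ∣ N H S ∣ ∣ S ∣
    bound-equal refl t≤s = inj₂ (inj₂ (≤-refl , subst (λ c → r * ∣ N H S ∣ ≤ c * ∣ S ∣) (sym choose-pred)
      (*-monoʳ-≤ r (∣N∣≤ (subst (length fs ≤_) (sym ∣S∣≡) t≤s)))))

    bound : Sizes (length xs) (length fs) → Bound r k ∣ N H S ∣ ∣ S ∣
    bound (inj₁ (k≡r , s≡r , t≤))        = bound-equal k≡r (subst (length fs ≤_) (sym s≡r) t≤)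
    bound (inj₂ (inj₁ (k≡r , r<s , t≤))) = bound-equal k≡r (≤-trans t≤ r<s)
    -- Multiply the bounds `r + 1 ≤ ∣ S ∣` and `∣ N H S ∣ ≤ k`.
    bound (inj₂ (inj₂ (k<r , r<s , t≤))) = inj₂ (inj₁ ((1<k , <⇒≤pred k<r)
      , subst (suc r * ∣ N H S ∣ ≤_) (*-comm ∣ S ∣ k) (*-mono-≤ (subst (r <_) (sym ∣S∣≡) r<s) (∣N∣≤ t≤))))
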